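{- For every $f\in\mathbb Q[x,y]$, $$\sum_{r\geq0}\mathcal G_r f(x,y)\,z^r=f\left(\frac{x}{1-yz},\ \frac{y(1-yz+xz)}{1-yz}\right),$$ where the right-hand side is expanded as a formal power series at $z=0$.
   Context: Work over $\mathbb Q$. With $D=\partial_x+\partial_y$, $\mathcal G_0=\mathrm{id}$ and, for $r\geq1$, $\mathcal G_r=y^r\sum_{j=1}^{r}\binom{r-1}{j-1}\frac{x^j}{j!}D^j$, operators on $\mathbb Q[x,y]$. The identity is in $\mathbb Q[x,y][[z]]$. -}

module Defs where

open import Algebra.Bundles using (RawRing; CommutativeRing)
import Algebra.Definitions.RawMonoid as RawMonoidDefs
import Algebra.Definitions.RawSemiring as RawSemiringDefs
import Algebra.Properties.CommutativeMonoid.Sum as CommutativeMonoidSum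
import Algebra.Properties.Semiring.Sum as SemiringSum
import Algebra.Properties.Group as GroupProperties
open import Data.Bool.Base using (true; false; _∧_; if_then_else_)
open import Data.Fin.Base using (toℕ)
open import Data.Fin.Properties using (toℕ<n)
open import Data.Integer.Base using (+_)
open import Data.List.Base using (List; []; _∷_; _++_; map; cartesianProductWith)
open import Data.Nat.Base as ℕ using (ℕ; zero; suc; _∸_; _≡ᵇ_; _!; s≤s; z≤n)
import Data.Nat.Properties as ℕ
open import Data.Nat.Properties using (_!≢0)
open import Data.Nat.Combinatorics.Base using (_C_)
open import Data.Nat.GeneralisedArithmetic using (iterate)
open import Data.Product.Base using (_,_)
open import Data.Rational.Base as ℚ using (ℚ; 0ℚ; 1ℚ; _/_)
import Data.Rational.Properties as ℚ
open import Level using (0ℓ)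
open import Relation.Binary.PropositionalEquality
  using (_≡_; refl; sym; trans; cong; cong₂; module ≡-Reasoning)
open import Relation.Binary.Structures using (IsEquivalence)
import Relation.Binary.Reasoning.Setoid as SetoidReasoning

record Term : Set where
  constructor _x^_y^_
  field
    scalar : ℚ
    xdeg   : ℕ
    ydeg   : ℕ

infix 8 _x^_y^_

-- A list of terms stands for their sum. Terms may repeat, come in any
-- order, or have scalar 0, so polynomials are compared by _≈ₚ_ below,
-- not by _≡_.
Poly : Set
Poly = List Term

termCoeff : Term → ℕ → ℕ → ℚ
termCoeff (c x^ i y^ j) k l = if (i ≡ᵇ k) ∧ (j ≡ᵇ l) then c else 0ℚ

coeff : Poly → ℕ → ℕ → ℚ
coeff []      k l = 0ℚ
coeff (t ∷ f) k l = termCoeff t k l ℚ.+ coeff f k l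

infix 4 _≈ₚ_

record _≈ₚ_ (f g : Poly) : Set where
  constructor mk≈
  field
    coeff≡ : ∀ k l → coeff f k l ≡ coeff g k l

open _≈ₚ_ public

const : ℚ → Poly
const c = c x^ 0 y^ 0 ∷ []

x y : Poly
x = 1ℚ x^ 1 y^ 0 ∷ []
y = 1ℚ x^ 0 y^ 1 ∷ []

_*ₜ_ : Term → Term → Term
(c x^ i y^ j) *ₜ (d x^ k y^ l) = (c ℚ.* d) x^ (i ℕ.+ k) y^ (j ℕ.+ l)

-ₜ_ : Term → Term
-ₜ (c x^ i y^ j) = (ℚ.- c) x^ i y^ j

rawℚ[x,y] : RawRing 0ℓ 0ℓ
rawℚ[x,y] = record
  { Carrier = Poly
  ; _≈_     = _≈ₚ_
  ; _+_     = _++_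
  ; _*_     = cartesianProductWith _*ₜ_
  ; -_      = map -ₜ_
  ; 0#      = []
  ; 1#      = const 1ℚ
  }

private
  module P = RawRing rawℚ[x,y]

  coeff-++ : ∀ f g k l → coeff (f ++ g) k l ≡ coeff f k l ℚ.+ coeff g k l
  coeff-++ []      g k l = sym (ℚ.+-identityˡ _)
  coeff-++ (t ∷ f) g k l =
    trans (cong (termCoeff t k l ℚ.+_) (coeff-++ f g k l))
          (sym (ℚ.+-assoc (termCoeff t k l) _ _))

  coeff-neg : ∀ f k l → coeff (P.- f) k l ≡ ℚ.- coeff f k l
  coeff-neg []      k l = refl
  coeff-neg (t@(c x^ i y^ j) ∷ f) k l =
    trans (cong₂ ℚ._+_ (lem ((i ≡ᵇ k) ∧ (j ≡ᵇ l))) (coeff-neg f k l))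
          (sym (ℚ.neg-distrib-+ (termCoeff t k l) (coeff f k l)))
    where
    lem : ∀ b → (if b then ℚ.- c else 0ℚ) ≡ ℚ.- (if b then c else 0ℚ)
    lem true  = refl
    lem false = refl

  ≈-isEquivalence : IsEquivalence _≈ₚ_
  ≈-isEquivalence = record
    { refl  = mk≈ λ k l → refl
    ; sym   = λ p → mk≈ λ k l → sym (coeff≡ p k l)
    ; trans = λ p q → mk≈ λ k l → trans (coeff≡ p k l) (coeff≡ q k l)
    }

  module E = IsEquivalence ≈-isEquivalence

  +-cong : ∀ {f f′ g g′} → f ≈ₚ f′ → g ≈ₚ g′ → f ++ g ≈ₚ f′ ++ g′
  +-cong {f} {f′} {g} {g′} p q = mk≈ λ k l →
    trans (coeff-++ f g k l)
      (trans (cong₂ ℚ._+_ (coeff≡ p k l) (coeff≡ q k l)) (sym (coeff-++ f′ g′ k l)))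

  +-comm : ∀ f g → f ++ g ≈ₚ g ++ f
  +-comm f g = mk≈ λ k l →
    trans (coeff-++ f g k l)
      (trans (ℚ.+-comm (coeff f k l) (coeff g k l)) (sym (coeff-++ g f k l)))

  +-assoc : ∀ f g h → (f ++ g) ++ h ≈ₚ f ++ (g ++ h)
  +-assoc []      g h = E.refl
  +-assoc (t ∷ f) g h = +-cong {t ∷ []} E.refl (+-assoc f g h)

  +-identityʳ : ∀ f → f ++ [] ≈ₚ f
  +-identityʳ f = +-comm f []

  neg-cong : ∀ {f g} → f ≈ₚ g → P.- f ≈ₚ P.- g
  neg-cong {f} {g} p = mk≈ λ k l →
    trans (coeff-neg f k l) (trans (cong ℚ.-_ (coeff≡ p k l)) (sym (coeff-neg g k l)))

  -‿inverseˡ : ∀ f → P.- f ++ f ≈ₚ []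
  -‿inverseˡ f = mk≈ λ k l →
    trans (coeff-++ (P.- f) f k l)
      (trans (cong (ℚ._+ coeff f k l) (coeff-neg f k l)) (ℚ.+-inverseˡ (coeff f k l)))

  -‿inverseʳ : ∀ f → f ++ P.- f ≈ₚ []
  -‿inverseʳ f = E.trans (+-comm f (P.- f)) (-‿inverseˡ f)

  -- coefficient (k , l) of c x^a y^b f, by recursion on the exponents
  shift : ℚ → ℕ → ℕ → (ℕ → ℕ → ℚ) → ℕ → ℕ → ℚ
  shift c zero    zero    u k       l       = c ℚ.* u k l
  shift c zero    (suc b) u k       zero    = 0ℚ
  shift c zero    (suc b) u k       (suc l) = shift c zero b u k l
  shift c (suc a) b       u zero    l       = 0ℚ
  shift c (suc a) b       u (suc k) l       = shift c a b u k l

  shift-cong : ∀ c a b {u v} → (∀ k l → u k l ≡ v k l) →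
               ∀ k l → shift c a b u k l ≡ shift c a b v k l
  shift-cong c zero    zero    p k       l       = cong (c ℚ.*_) (p k l)
  shift-cong c zero    (suc b) p k       zero    = refl
  shift-cong c zero    (suc b) p k       (suc l) = shift-cong c zero b p k l
  shift-cong c (suc a) b       p zero    l       = refl
  shift-cong c (suc a) b       p (suc k) l       = shift-cong c a b p k l

  shift-0 : ∀ c a b k l → shift c a b (λ _ _ → 0ℚ) k l ≡ 0ℚ
  shift-0 c zero    zero    k       l       = ℚ.*-zeroʳ c
  shift-0 c zero    (suc b) k       zero    = refl
  shift-0 c zero    (suc b) k       (suc l) = shift-0 c zero b k l
  shift-0 c (suc a) b       zero    l       = refl
  shift-0 c (suc a) b       (suc k) l       = shift-0 c a b k l

  shift-+ : ∀ c a b u v k l →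
            shift c a b (λ m n → u m n ℚ.+ v m n) k l ≡ shift c a b u k l ℚ.+ shift c a b v k l
  shift-+ c zero    zero    u v k       l       = ℚ.*-distribˡ-+ c (u k l) (v k l)
  shift-+ c zero    (suc b) u v k       zero    = refl
  shift-+ c zero    (suc b) u v k       (suc l) = shift-+ c zero b u v k l
  shift-+ c (suc a) b       u v zero    l       = refl
  shift-+ c (suc a) b       u v (suc k) l       = shift-+ c a b u v k l

  ∧-false : ∀ b {c : ℚ} → 0ℚ ≡ (if b ∧ false then c else 0ℚ)
  ∧-false true  = refl
  ∧-false false = refl

  shift-term : ∀ c a b t k l →
               termCoeff ((c x^ a y^ b) *ₜ t) k l ≡ shift c a b (termCoeff t) k l
  shift-term c zero zero (d x^ i y^ j) k l with (i ≡ᵇ k) ∧ (j ≡ᵇ l)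
  ... | true  = refl
  ... | false = sym (ℚ.*-zeroʳ c)
  shift-term c zero    (suc b) (d x^ i y^ j) k       zero    = sym (∧-false (i ≡ᵇ k))
  shift-term c zero    (suc b) t             k       (suc l) = shift-term c zero b t k l
  shift-term c (suc a) b       t             zero    l       = refl
  shift-term c (suc a) b       t             (suc k) l       = shift-term c a b t k l

  coeff-term* : ∀ c a b f k l →
                coeff (map ((c x^ a y^ b) *ₜ_) f) k l ≡ shift c a b (coeff f) k l
  coeff-term* c a b []      k l = sym (shift-0 c a b k l)
  coeff-term* c a b (t ∷ f) k l =
    trans (cong₂ ℚ._+_ (shift-term c a b t k l) (coeff-term* c a b f k l))
          (sym (shift-+ c a b (termCoeff t) (coeff f) k l))

  term*-cong : ∀ t {f g} → f ≈ₚ g → map (t *ₜ_) f ≈ₚ map (t *ₜ_) g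
  term*-cong (c x^ a y^ b) {f} {g} p = mk≈ λ k l →
    trans (coeff-term* c a b f k l)
      (trans (shift-cong c a b (coeff≡ p) k l) (sym (coeff-term* c a b g k l)))

  *-congˡ : ∀ f {g h} → g ≈ₚ h → f P.* g ≈ₚ f P.* h
  *-congˡ []      p = E.refl
  *-congˡ (t ∷ f) p = +-cong (term*-cong t p) (*-congˡ f p)

  *ₜ-comm : ∀ s t → s *ₜ t ≡ t *ₜ s
  *ₜ-comm (c x^ i y^ j) (d x^ k y^ l)
    rewrite ℚ.*-comm c d | ℕ.+-comm i k | ℕ.+-comm j l = refl

  *ₜ-assoc : ∀ s t u → (s *ₜ t) *ₜ u ≡ s *ₜ (t *ₜ u)
  *ₜ-assoc (c x^ i y^ j) (d x^ k y^ l) (e x^ m y^ n)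
    rewrite ℚ.*-assoc c d e | ℕ.+-assoc i k m | ℕ.+-assoc j l n = refl

  swap : ∀ f g h → f ++ (g ++ h) ≈ₚ g ++ (f ++ h)
  swap f g h = E.trans (E.sym (+-assoc f g h))
    (E.trans (+-cong (+-comm f g) E.refl) (+-assoc g f h))

  *-zeroʳ : ∀ f → f P.* [] ≈ₚ []
  *-zeroʳ []      = E.refl
  *-zeroʳ (t ∷ f) = *-zeroʳ f

  *-consʳ : ∀ f t g → f P.* (t ∷ g) ≈ₚ map (t *ₜ_) f ++ f P.* g
  *-consʳ []      t g = E.refl
  *-consʳ (s ∷ f) t g rewrite *ₜ-comm s t =
    +-cong {t *ₜ s ∷ []} E.refl
      (E.trans (+-cong {map (s *ₜ_) g} E.refl (*-consʳ f t g))
               (swap (map (s *ₜ_) g) (map (t *ₜ_) f) (f P.* g)))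

  *-comm : ∀ f g → f P.* g ≈ₚ g P.* f
  *-comm []      g = E.sym (*-zeroʳ g)
  *-comm (t ∷ f) g =
    E.trans (+-cong {map (t *ₜ_) g} E.refl (*-comm f g)) (E.sym (*-consʳ g t f))

  *-cong : ∀ {f f′ g g′} → f ≈ₚ f′ → g ≈ₚ g′ → f P.* g ≈ₚ f′ P.* g′
  *-cong {f} {f′} {g} {g′} p q =
    E.trans (*-congˡ f q)
      (E.trans (*-comm f g′) (E.trans (*-congˡ g′ p) (*-comm g′ f′)))

  distribʳ : ∀ f g h → (g ++ h) P.* f ≈ₚ g P.* f ++ h P.* f
  distribʳ f []      h = E.refl
  distribʳ f (t ∷ g) h =
    E.trans (+-cong {map (t *ₜ_) f} E.refl (distribʳ f g h))
            (E.sym (+-assoc (map (t *ₜ_) f) (g P.* f) (h P.* f)))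

  distribˡ : ∀ f g h → f P.* (g ++ h) ≈ₚ f P.* g ++ f P.* h
  distribˡ f g h = E.trans (*-comm f (g ++ h))
    (E.trans (distribʳ f g h) (+-cong (*-comm g f) (*-comm h f)))

  map-assoc : ∀ s t f → map ((s *ₜ t) *ₜ_) f ≈ₚ map (s *ₜ_) (map (t *ₜ_) f)
  map-assoc s t []      = E.refl
  map-assoc s t (u ∷ f) rewrite *ₜ-assoc s t u =
    +-cong {s *ₜ (t *ₜ u) ∷ []} E.refl (map-assoc s t f)

  map-++ : ∀ s f g → map (s *ₜ_) (f ++ g) ≈ₚ map (s *ₜ_) f ++ map (s *ₜ_) g
  map-++ s []      g = E.refl
  map-++ s (t ∷ f) g = +-cong {s *ₜ t ∷ []} E.refl (map-++ s f g)

  term*-assoc : ∀ s f g → map (s *ₜ_) f P.* g ≈ₚ map (s *ₜ_) (f P.* g)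
  term*-assoc s []      g = E.refl
  term*-assoc s (t ∷ f) g =
    E.trans (+-cong (map-assoc s t g) (term*-assoc s f g))
            (E.sym (map-++ s (map (t *ₜ_) g) (f P.* g)))

  *-assoc : ∀ f g h → (f P.* g) P.* h ≈ₚ f P.* (g P.* h)
  *-assoc []      g h = E.refl
  *-assoc (t ∷ f) g h =
    E.trans (distribʳ h (map (t *ₜ_) g) (f P.* g))
            (+-cong (term*-assoc t g h) (*-assoc f g h))

  *-identityˡ : ∀ f → P.1# P.* f ≈ₚ f
  *-identityˡ f = E.trans (+-identityʳ _) (mk≈ λ k l →
    trans (coeff-term* 1ℚ 0 0 f k l) (ℚ.*-identityˡ (coeff f k l)))

ℚ[x,y] : CommutativeRing 0ℓ 0ℓ
ℚ[x,y] = record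
  { RawRing rawℚ[x,y]
  ; isCommutativeRing = record
    { isRing = record
      { +-isAbelianGroup = record
        { isGroup = record
          { isMonoid = record
            { isSemigroup = record
              { isMagma = record { isEquivalence = ≈-isEquivalence ; ∙-cong = +-cong }
              ; assoc   = +-assoc
              }
            ; identity = (λ f → E.refl) , +-identityʳ
            }
          ; inverse = -‿inverseˡ , -‿inverseʳ
          ; ⁻¹-cong = neg-cong
          }
        ; comm = +-comm
        }
      ; *-cong     = *-cong
      ; *-assoc    = *-assoc
      ; *-identity = *-identityˡ , λ f → E.trans (*-comm f P.1#) (*-identityˡ f)
      ; distrib    = distribˡ , distribʳ
      }
    ; *-comm = *-comm
    }
  }

module PowerSeries {c ℓ} (R : CommutativeRing c ℓ) where

  private
    module R = CommutativeRing R
    open RawMonoidDefs R.+-rawMonoid using (sum)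

  Series : Set c
  Series = ℕ → R.Carrier

  constant : R.Carrier → Series
  constant a zero    = a
  constant a (suc n) = R.0#

  z : Series
  z zero          = R.0#
  z (suc zero)    = R.1#
  z (suc (suc n)) = R.0#

  rawR[[z]] : RawRing c ℓ
  rawR[[z]] = record
    { Carrier = Series
    ; _≈_     = λ p q → ∀ n → p n R.≈ q n
    ; _+_     = λ p q n → p n R.+ q n
    ; _*_     = λ p q n → sum {suc n} λ i → p (toℕ i) R.* q (n ∸ toℕ i)
    ; -_      = λ p n → R.- p n
    ; 0#      = λ n → R.0#
    ; 1#      = constant R.1#
    }

  open RawRing rawR[[z]] public using (_≈_; _+_; _*_; -_; 0#; 1#; rawSemiring)
  open RawSemiringDefs rawSemiring public using (_^_)

  infixl 6 _-_
  _-_ : Series → Series → Series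
  p - q = p + (- q)

  -- The reciprocal of a series with constant term 1, expanded as the
  -- geometric series Σ_k (1 - p)^k. Only the powers k ≤ n contribute to the
  -- coefficient of z^n. The value is irrelevant for other series.
  infix 8 _⁻¹
  _⁻¹ : Series → Series
  (p ⁻¹) n = sum {suc n} λ k → ((1# - p) ^ toℕ k) n

  private
    open CommutativeMonoidSum R.+-commutativeMonoid
      using (sum-cong-≋; sum-replicate-zero; ∑-distrib-+; ∑-comm)
    open SemiringSum R.semiring using (*-distribˡ-sum)
    open GroupProperties R.+-group using (∙-cancelˡ)
    open SetoidReasoning R.setoid

    *-cong-<ʳ : ∀ h u v n → h 0 R.≈ R.0# → (∀ m → m ℕ.< n → u m R.≈ v m) →
                (h * u) n R.≈ (h * v) n
    *-cong-<ʳ h u v n h₀ p = R.+-cong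
      (R.trans (vanish u) (R.sym (vanish v)))
      (sum-cong-≋ λ i → R.*-congˡ (p _ (ℕ.∸-monoʳ-< (s≤s z≤n) (toℕ<n i))))
      where
      vanish : ∀ w → h 0 R.* w n R.≈ R.0#
      vanish w = R.trans (R.*-congʳ h₀) (R.zeroˡ (w n))

    *-identityˡ-≈ : ∀ q → 1# * q ≈ q
    *-identityˡ-≈ q n = begin
      R.1# R.* q n R.+ sum {n} (λ i → R.0# R.* q (n ∸ suc (toℕ i)))
        ≈⟨ R.+-cong (R.*-identityˡ (q n)) (R.trans (sum-cong-≋ {n} λ i → R.zeroˡ (q (n ∸ suc (toℕ i)))) (sum-replicate-zero n)) ⟩
      q n R.+ R.0#
        ≈⟨ R.+-identityʳ (q n) ⟩
      q n ∎

    geometric : Series → ℕ → Series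
    geometric h m n = sum {m} λ k → (h ^ toℕ k) n

    geometric-suc : ∀ h m → geometric h (suc m) ≈ 1# + h * geometric h m
    geometric-suc h m n = R.+-congˡ (begin
      sum {m} (λ k → sum {suc n} λ i → h (toℕ i) R.* (h ^ toℕ k) (n ∸ toℕ i))
        ≈⟨ ∑-comm {m} {suc n} (λ k i → h (toℕ i) R.* (h ^ toℕ k) (n ∸ toℕ i)) ⟩
      sum {suc n} (λ i → sum {m} λ k → h (toℕ i) R.* (h ^ toℕ k) (n ∸ toℕ i))
        ≈⟨ sum-cong-≋ {suc n} (λ i → *-distribˡ-sum {m} (h (toℕ i)) (λ k → (h ^ toℕ k) (n ∸ toℕ i))) ⟨
      (h * geometric h m) n ∎)

    geometric-stable : ∀ h → h 0 R.≈ R.0# → ∀ m m′ n → n ℕ.< m → n ℕ.< m′ →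
                       geometric h m n R.≈ geometric h m′ n
    geometric-stable h h₀ (suc m) (suc m′) n (s≤s n≤m) (s≤s n≤m′) = begin
      geometric h (suc m) n           ≈⟨ geometric-suc h m n ⟩
      1# n R.+ (h * geometric h m) n  ≈⟨ R.+-congˡ (*-cong-<ʳ h (geometric h m) (geometric h m′) n h₀ λ l l<n →
                                           geometric-stable h h₀ m m′ l (ℕ.≤-trans l<n n≤m) (ℕ.≤-trans l<n n≤m′)) ⟩
      1# n R.+ (h * geometric h m′) n ≈⟨ geometric-suc h m′ n ⟨
      geometric h (suc m′) n          ∎

  ⁻¹-inverseʳ : ∀ p → p 0 R.≈ R.1# → p * p ⁻¹ ≈ 1#
  ⁻¹-inverseʳ p p₀ n = ∙-cancelˡ ((h * q) n) _ _ (begin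
    (h * q) n R.+ (p * q) n
      ≈⟨ ∑-distrib-+ {suc n} (λ i → h (toℕ i) R.* q (n ∸ toℕ i)) (λ i → p (toℕ i) R.* q (n ∸ toℕ i)) ⟨
    sum {suc n} (λ i → h (toℕ i) R.* q (n ∸ toℕ i) R.+ p (toℕ i) R.* q (n ∸ toℕ i))
      ≈⟨ sum-cong-≋ {suc n} (λ i → R.trans (R.sym (R.distribʳ (q (n ∸ toℕ i)) (h (toℕ i)) (p (toℕ i)))) (R.*-congʳ (h+p (toℕ i)))) ⟩
    (1# * q) n
      ≈⟨ *-identityˡ-≈ q n ⟩
    q n
      ≈⟨ geometric-suc h n n ⟩
    1# n R.+ (h * geometric h n) n
      ≈⟨ R.+-congˡ (*-cong-<ʳ h (geometric h n) q n h₀ λ l l<n → geometric-stable h h₀ n (suc l) l l<n (ℕ.n<1+n l)) ⟩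
    1# n R.+ (h * q) n
      ≈⟨ R.+-comm _ _ ⟩
    (h * q) n R.+ 1# n ∎)
    where
    h q : Series
    h = 1# - p
    q = p ⁻¹

    h₀ : h 0 R.≈ R.0#
    h₀ = R.trans (R.+-congˡ (R.-‿cong p₀)) (R.-‿inverseʳ R.1#)

    h+p : h + p ≈ 1#
    h+p m = R.trans (R.+-assoc _ _ _)
      (R.trans (R.+-congˡ (R.-‿inverseˡ (p m))) (R.+-identityʳ _))

open PowerSeries ℚ[x,y] public

infix 9 _⟦_,_⟧
_⟦_,_⟧ : Poly → Series → Series → Series
[]                ⟦ p , q ⟧ = 0#
(c x^ i y^ j ∷ f) ⟦ p , q ⟧ = constant (const c) * (p ^ i * q ^ j) + f ⟦ p , q ⟧

∂xₜ ∂yₜ : Term → Term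
∂xₜ (c x^ i y^ j) = (+ i / 1 ℚ.* c) x^ (i ∸ 1) y^ j
∂yₜ (c x^ i y^ j) = (+ j / 1 ℚ.* c) x^ i y^ (j ∸ 1)

∂x ∂y D : Poly → Poly
∂x = map ∂xₜ
∂y = map ∂yₜ
D f = ∂x f P.+ ∂y f

open RawSemiringDefs P.rawSemiring using (sum) renaming (_^_ to _^ₚ_)

-- The summation index i runs over 0 ≤ i < r, and j = i + 1.
𝒢 : ℕ → Poly → Poly
𝒢 zero      f = f
𝒢 r@(suc _) f = y ^ₚ r P.* sum {r} λ i →
  let j = suc (toℕ i)
      instance _ = j !≢0
  in const (+ ((r ∸ 1) C (j ∸ 1)) / 1) P.* (const (+ 1 / j !) P.* x ^ₚ j) P.* iterate D f j

{-# OPTIONS --safe #-}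

-- Write T f = Σ_r 𝒢 r f z^r. Since D (x f) = f + x D f and likewise for y,
-- the commutator of 𝒢 r with multiplication by x and by y is the same
-- operator ℋ r, and Pascal's rule gives ℋ (r + 1) = x y 𝒢 r + y ℋ r. For
-- the generating functions this says (1 - y z) H = x y z T, whence
-- T (x f) = x / (1 - y z) · T f and
-- T (y f) = y (1 - y z + x z) / (1 - y z) · T f. As T is additive and fixes
-- constants, it is determined on monomials.

module Submission where

open import Algebra.Bundles using (CommutativeRing; CommutativeSemiring)
import Algebra.Definitions.RawSemiring as RawSemiringDefs
import Algebra.Properties.CommutativeSemigroup as CommutativeSemigroupProperties
import Algebra.Properties.Group as GroupProperties
import Algebra.Properties.Semiring.Sum as SemiringSum
import Algebra.Solver.Ring.NaturalCoefficients.Default as SemiringSolver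
open import Data.Bool.Base as Bool using (true; false; _∧_; if_then_else_)
open import Data.Bool.Properties using (∧-comm; ∧-zeroʳ; if-eta)
open import Data.Fin.Base as Fin using (toℕ)
import Data.Fin.Properties as Fin
open import Data.Integer.Base as ℤ using (+_)
import Data.Integer.Properties as ℤ
open import Data.List.Base using ([]; _∷_; _++_)
open import Data.List.Properties using (map-++)
open import Data.Nat.Base as ℕ using (ℕ; zero; suc; _∸_; _≡ᵇ_)
open import Data.Nat.Combinatorics using (_C_; nCk+nC[k+1]≡[n+1]C[k+1]; k>n⇒nCk≡0)
open import Data.Nat.GeneralisedArithmetic using (iterate)
import Data.Nat.Properties as ℕ
open import Data.Nat.Properties using (_!≢0)
open import Data.Product.Base using (_,_)
open import Data.Rational.Base as ℚ using (ℚ; 0ℚ; 1ℚ; _/_)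
import Data.Rational.Properties as ℚ
import Data.Rational.Unnormalised.Base as ℚᵘ
import Data.Rational.Unnormalised.Properties as ℚᵘ
open import Level using (_⊔_)
open import Relation.Binary.PropositionalEquality as ≡ using (_≡_)
import Relation.Binary.Reasoning.Setoid as SetoidReasoning

open import Defs using (module PowerSeries)

-- Power series over a commutative ring form a commutative ring.

module CauchyProduct {c ℓ} (R : CommutativeRing c ℓ) where

  private
    module R = CommutativeRing R
  open PowerSeries R
  open SemiringSum R.semiring using (sum; sum-cong-≋; sum-replicate-zero; ∑-distrib-+; *-distribˡ-sum)
  open SetoidReasoning R.setoid

  tail : Series → Series
  tail p n = p (suc n)

  *-cong : ∀ {p p′ q q′} → p ≈ p′ → q ≈ q′ → p * q ≈ p′ * q′
  *-cong p≈p′ q≈q′ n = sum-cong-≋ {suc n} λ i → R.*-cong (p≈p′ (toℕ i)) (q≈q′ (n ∸ toℕ i))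

  *-zero : ∀ p q → (p * q) 0 R.≈ p 0 R.* q 0
  *-zero p q = R.+-identityʳ (p 0 R.* q 0)

  -- The product unfolds by splitting off the constant term of the left factor; this is the mirror
  -- image for the right factor. Played against each other, the two expansions give commutativity by
  -- induction on the index.
  *-sucʳ : ∀ p q n → (p * q) (suc n) R.≈ (p * tail q) n R.+ p (suc n) R.* q 0
  *-sucʳ p q zero    = R.+-cong (R.sym (*-zero p (tail q))) (*-zero (tail p) q)
  *-sucʳ p q (suc n) = begin
    p 0 R.* q (2 ℕ.+ n) R.+ (tail p * q) (suc n)
      ≈⟨ R.+-congˡ (*-sucʳ (tail p) q n) ⟩
    p 0 R.* q (2 ℕ.+ n) R.+ ((tail p * tail q) n R.+ p (2 ℕ.+ n) R.* q 0)
      ≈⟨ R.+-assoc _ _ _ ⟨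
    (p * tail q) (suc n) R.+ p (2 ℕ.+ n) R.* q 0 ∎

  *-comm : ∀ p q → p * q ≈ q * p
  *-comm p q zero    = R.+-congʳ (R.*-comm (p 0) (q 0))
  *-comm p q (suc n) = begin
    (p * q) (suc n)                       ≈⟨ *-sucʳ p q n ⟩
    (p * tail q) n R.+ p (suc n) R.* q 0  ≈⟨ R.+-cong (*-comm p (tail q) n) (R.*-comm (p (suc n)) (q 0)) ⟩
    (tail q * p) n R.+ q 0 R.* p (suc n)  ≈⟨ R.+-comm _ _ ⟩
    (q * p) (suc n)                       ∎

  distribʳ : ∀ r p q → (p + q) * r ≈ p * r + q * r
  distribʳ r p q n = R.trans
    (sum-cong-≋ {suc n} λ i → R.distribʳ (r (n ∸ toℕ i)) (p (toℕ i)) (q (toℕ i)))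
    (∑-distrib-+ {suc n} (λ i → p (toℕ i) R.* r (n ∸ toℕ i)) (λ i → q (toℕ i) R.* r (n ∸ toℕ i)))

  distribˡ : ∀ r p q → r * (p + q) ≈ r * p + r * q
  distribˡ r p q n = R.trans (*-comm r (p + q) n)
    (R.trans (distribʳ r p q n) (R.+-cong (*-comm p r n) (*-comm q r n)))

  zeroˡ : ∀ q → 0# * q ≈ 0#
  zeroˡ q n = R.trans (sum-cong-≋ {suc n} λ i → R.zeroˡ (q (n ∸ toℕ i))) (sum-replicate-zero (suc n))

  constant-* : ∀ a q n → (constant a * q) n R.≈ a R.* q n
  constant-* a q zero    = *-zero (constant a) q
  constant-* a q (suc n) = R.trans (R.+-congˡ (zeroˡ q n)) (R.+-identityʳ _)

  scale-* : ∀ a p q n → ((λ m → a R.* p m) * q) n R.≈ a R.* (p * q) n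
  scale-* a p q n = R.trans
    (sum-cong-≋ {suc n} λ i → R.*-assoc a (p (toℕ i)) (q (n ∸ toℕ i)))
    (R.sym (*-distribˡ-sum {suc n} a (λ i → p (toℕ i) R.* q (n ∸ toℕ i))))

  -- Induction on the index with `p` general: the step needs the claim for `tail p` at the previous
  -- index.
  *-assoc : ∀ p q r → (p * q) * r ≈ p * (q * r)
  *-assoc p q r zero    = begin
    ((p * q) * r) 0            ≈⟨ *-zero (p * q) r ⟩
    (p * q) 0 R.* r 0          ≈⟨ R.*-congʳ (*-zero p q) ⟩
    p 0 R.* q 0 R.* r 0        ≈⟨ R.*-assoc (p 0) (q 0) (r 0) ⟩
    p 0 R.* (q 0 R.* r 0)      ≈⟨ R.*-congˡ (*-zero q r) ⟨
    p 0 R.* (q * r) 0          ≈⟨ *-zero p (q * r) ⟨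
    (p * (q * r)) 0            ∎
  *-assoc p q r (suc n) = begin
    -- By definition `tail (p * q)` is `p 0` times `tail q`, plus `tail p * q`.
    (p * q) 0 R.* r (suc n) R.+ (tail (p * q) * r) n
      ≈⟨ R.+-cong (R.trans (R.*-congʳ (*-zero p q)) (R.*-assoc (p 0) (q 0) (r (suc n))))
                  (distribʳ r (λ m → p 0 R.* tail q m) (tail p * q) n) ⟩
    p 0 R.* (q 0 R.* r (suc n)) R.+ (((λ m → p 0 R.* tail q m) * r) n R.+ ((tail p * q) * r) n)
      ≈⟨ R.+-congˡ (R.+-cong (scale-* (p 0) (tail q) r n) (*-assoc (tail p) q r n)) ⟩
    p 0 R.* (q 0 R.* r (suc n)) R.+ (p 0 R.* (tail q * r) n R.+ (tail p * (q * r)) n)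
      ≈⟨ R.+-assoc _ _ _ ⟨
    p 0 R.* (q 0 R.* r (suc n)) R.+ p 0 R.* (tail q * r) n R.+ (tail p * (q * r)) n
      ≈⟨ R.+-congʳ (R.distribˡ (p 0) (q 0 R.* r (suc n)) ((tail q * r) n)) ⟨
    (p * (q * r)) (suc n) ∎

  *-identityˡ : ∀ q → 1# * q ≈ q
  *-identityˡ q n = R.trans (constant-* R.1# q n) (R.*-identityˡ (q n))

  R[[z]] : CommutativeRing c ℓ
  R[[z]] = record
    { _≈_ = _≈_ ; _+_ = _+_ ; _*_ = _*_ ; -_ = -_ ; 0# = 0# ; 1# = 1#
    ; isCommutativeRing = record
      { isRing = record
        { +-isAbelianGroup = record
          { isGroup = record
            { isMonoid = record
              { isSemigroup = record
                { isMagma = record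
                  { isEquivalence = record
                    { refl  = λ n → R.refl
                    ; sym   = λ p≈q n → R.sym (p≈q n)
                    ; trans = λ p≈q q≈r n → R.trans (p≈q n) (q≈r n)
                    }
                  ; ∙-cong = λ p≈p′ q≈q′ n → R.+-cong (p≈p′ n) (q≈q′ n)
                  }
                ; assoc = λ p q r n → R.+-assoc (p n) (q n) (r n)
                }
              ; identity = (λ p n → R.+-identityˡ (p n)) , (λ p n → R.+-identityʳ (p n))
              }
            ; inverse = (λ p n → R.-‿inverseˡ (p n)) , (λ p n → R.-‿inverseʳ (p n))
            ; ⁻¹-cong = λ p≈q n → R.-‿cong (p≈q n)
            }
          ; comm = λ p q n → R.+-comm (p n) (q n)
          }
        ; *-cong     = *-cong
        ; *-assoc    = *-assoc
        ; *-identity = *-identityˡ , (λ p n → R.trans (*-comm p 1# n) (*-identityˡ p n))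
        ; distrib    = distribˡ , distribʳ
        }
      ; *-comm = *-comm
      }
    }

  z-*-zero : ∀ q → (z * q) 0 R.≈ R.0#
  z-*-zero q = R.trans (*-zero z q) (R.zeroˡ (q 0))

  z-*-suc : ∀ q n → (z * q) (suc n) R.≈ q n
  z-*-suc q n = begin
    R.0# R.* q (suc n) R.+ (tail z * q) n
      ≈⟨ R.+-cong (R.zeroˡ (q (suc n))) (R.trans (*-cong {tail z} {1#} {q} tail-z (λ _ → R.refl) n) (*-identityˡ q n)) ⟩
    R.0# R.+ q n
      ≈⟨ R.+-identityˡ (q n) ⟩
    q n ∎
    where
    tail-z : tail z ≈ 1#
    tail-z zero    = R.refl
    tail-z (suc n) = R.refl

-- Natural numbers and reciprocals of factorials as rationals.

natℚ : ℕ → ℚ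
natℚ n = + n / 1

-- Fractions in `ℚ` are kept normalised, so the identity is checked among unnormalised fractions,
-- where it is a comparison of cross products.
natℚ-+ : ∀ m n → natℚ (m ℕ.+ n) ≡ natℚ m ℚ.+ natℚ n
natℚ-+ m n = ℚ.toℚᵘ-injective (begin
  ℚ.toℚᵘ (natℚ (m ℕ.+ n))                  ≈⟨ ℚ.toℚᵘ-fromℚᵘ (ℚᵘ.mkℚᵘ (+ (m ℕ.+ n)) 0) ⟩
  ℚᵘ.mkℚᵘ (+ (m ℕ.+ n)) 0                  ≈⟨ ℚᵘ.*≡* (≡.cong (ℤ._* + 1) (≡.sym (≡.cong₂ ℤ._+_ (ℤ.*-identityʳ (+ m)) (ℤ.*-identityʳ (+ n))))) ⟩
  ℚᵘ.mkℚᵘ (+ m) 0 ℚᵘ.+ ℚᵘ.mkℚᵘ (+ n) 0     ≈⟨ ℚᵘ.+-cong (ℚ.toℚᵘ-fromℚᵘ (ℚᵘ.mkℚᵘ (+ m) 0)) (ℚ.toℚᵘ-fromℚᵘ (ℚᵘ.mkℚᵘ (+ n) 0)) ⟨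
  ℚ.toℚᵘ (natℚ m) ℚᵘ.+ ℚ.toℚᵘ (natℚ n)     ≈⟨ ℚ.toℚᵘ-homo-+ (natℚ m) (natℚ n) ⟨
  ℚ.toℚᵘ (natℚ m ℚ.+ natℚ n)               ∎)
  where open SetoidReasoning ℚᵘ.≃-setoid

-- Meant for m = j + 1 and n = j!, where m n is (j + 1)!.
1/mn*m≡1/n : ∀ m n .{{_ : ℕ.NonZero m}} .{{_ : ℕ.NonZero n}} .{{_ : ℕ.NonZero (m ℕ.* n)}} →
             (+ 1 / (m ℕ.* n)) ℚ.* natℚ m ≡ + 1 / n
1/mn*m≡1/n m@(suc m-1) n@(suc n-1) = ℚ.toℚᵘ-injective (begin
  ℚ.toℚᵘ ((+ 1 / (m ℕ.* n)) ℚ.* natℚ m)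
    ≈⟨ ℚ.toℚᵘ-homo-* (+ 1 / (m ℕ.* n)) (natℚ m) ⟩
  ℚ.toℚᵘ (+ 1 / (m ℕ.* n)) ℚᵘ.* ℚ.toℚᵘ (natℚ m)
    ≈⟨ ℚᵘ.*-cong (ℚ.toℚᵘ-fromℚᵘ (ℚᵘ.mkℚᵘ (+ 1) (n-1 ℕ.+ m-1 ℕ.* n))) (ℚ.toℚᵘ-fromℚᵘ (ℚᵘ.mkℚᵘ (+ m) 0)) ⟩
  ℚᵘ.mkℚᵘ (+ 1) (n-1 ℕ.+ m-1 ℕ.* n) ℚᵘ.* ℚᵘ.mkℚᵘ (+ m) 0
    ≈⟨ ℚᵘ.*≡* (≡.cong +_ cross) ⟩
  ℚᵘ.mkℚᵘ (+ 1) n-1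
    ≈⟨ ℚ.toℚᵘ-fromℚᵘ (ℚᵘ.mkℚᵘ (+ 1) n-1) ⟨
  ℚ.toℚᵘ (+ 1 / n) ∎)
  where
  open SetoidReasoning ℚᵘ.≃-setoid
  cross : 1 ℕ.* m ℕ.* n ≡ 1 ℕ.* (m ℕ.* n ℕ.* 1)
  cross = ≡.trans (≡.cong (ℕ._* n) (ℕ.*-identityˡ m))
            (≡.sym (≡.trans (ℕ.*-identityˡ _) (ℕ.*-identityʳ (m ℕ.* n))))

-- Commutative rings with rational scalars and an operator `D` obeying a product rule for x and y.

record DifferentialAlgebra {c ℓ} (R : CommutativeRing c ℓ) : Set (c ⊔ ℓ) where
  open CommutativeRing R
  field
    x y    : Carrier
    ι      : ℚ → Carrier
    ι-0    : ι 0ℚ ≈ 0#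
    ι-1    : ι 1ℚ ≈ 1#
    ι-+    : ∀ a b → ι (a ℚ.+ b) ≈ ι a + ι b
    ι-*    : ∀ a b → ι (a ℚ.* b) ≈ ι a * ι b
    D      : Carrier → Carrier
    D-cong : ∀ {f g} → f ≈ g → D f ≈ D g
    D-+    : ∀ f g → D (f + g) ≈ D f + D g
    -- The Leibniz rule for multiplication by a variable, with D x = D y = 1 built in.
    D-x    : ∀ f → D (x * f) ≈ f + x * D f
    D-y    : ∀ f → D (y * f) ≈ f + y * D f

-- Divided powers of `D`, the operators `𝒢` and their commutators `ℋ`.

module DividedPowers {c ℓ} (R : CommutativeRing c ℓ) (A : DifferentialAlgebra R) where

  open CommutativeRing R
  open DifferentialAlgebra A
  open RawSemiringDefs (CommutativeSemiring.rawSemiring commutativeSemiring) using (_×_; _^_)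
  open SemiringSum semiring
    using (sum; sum-cong-≋; sum-init-last; ∑-distrib-+; *-distribˡ-sum; sum-replicate-zero)
  open GroupProperties +-group using (identityˡ-unique)
  open SemiringSolver commutativeSemiring using (solve; _:=_; _:+_; _:*_)
  open SetoidReasoning setoid

  binomialSum : ℕ → (ℕ → Carrier) → Carrier
  binomialSum n a = sum {suc n} λ i → ι (natℚ (n C toℕ i)) * a (toℕ i)

  binomialSum-cong : ∀ n {a b} → (∀ i → a i ≈ b i) → binomialSum n a ≈ binomialSum n b
  binomialSum-cong n a≈b = sum-cong-≋ {suc n} λ i → *-congˡ {ι (natℚ (n C toℕ i))} (a≈b (toℕ i))

  binomialSum-+ : ∀ n a b → binomialSum n (λ i → a i + b i) ≈ binomialSum n a + binomialSum n b
  binomialSum-+ n a b = trans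
    (sum-cong-≋ {suc n} λ i → distribˡ (ι (natℚ (n C toℕ i))) (a (toℕ i)) (b (toℕ i)))
    (∑-distrib-+ {suc n} (λ i → ι (natℚ (n C toℕ i)) * a (toℕ i)) (λ i → ι (natℚ (n C toℕ i)) * b (toℕ i)))

  binomialSum-* : ∀ n u a → binomialSum n (λ i → u * a i) ≈ u * binomialSum n a
  binomialSum-* n u a = trans
    (sum-cong-≋ {suc n} λ i → solve 3 (λ k u a → k :* (u :* a) := u :* (k :* a)) refl
      (ι (natℚ (n C toℕ i))) u (a (toℕ i)))
    (sym (*-distribˡ-sum {suc n} u (λ i → ι (natℚ (n C toℕ i)) * a (toℕ i))))

  binomialSum-0 : ∀ n {a} → (∀ i → a i ≈ 0#) → binomialSum n a ≈ 0#
  binomialSum-0 n a≈0 = trans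
    (sum-cong-≋ {suc n} λ i → trans (*-congˡ (a≈0 (toℕ i))) (zeroʳ (ι (natℚ (n C toℕ i)))))
    (sum-replicate-zero (suc n))

  -- Pascal's rule splits every coefficient of positive lower index into two. The half that keeps
  -- its index runs one place too far, up to n choose n + 1, and that coefficient is 0.
  binomialSum-suc : ∀ n a →
    binomialSum (suc n) a ≈ binomialSum n a + binomialSum n (λ i → a (suc i))
  binomialSum-suc n a = begin
    -- The coefficients `suc n C 0` and `n C 0` agree by computation, so the first summand is
    -- already `t 0`.
    t 0 + sum {suc n} (λ i → ι (natℚ (suc n C suc (toℕ i))) * a (suc (toℕ i)))
      ≈⟨ +-congˡ (sum-cong-≋ {suc n} λ i → pascal (toℕ i)) ⟩
    t 0 + sum {suc n} (λ i → t (suc (toℕ i)) + s (toℕ i))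
      ≈⟨ +-congˡ (∑-distrib-+ {suc n} (λ i → t (suc (toℕ i))) (λ i → s (toℕ i))) ⟩
    t 0 + (sum {suc n} (λ i → t (suc (toℕ i))) + binomialSum n (λ i → a (suc i)))
      ≈⟨ +-assoc _ _ _ ⟨
    sum {2 ℕ.+ n} (λ i → t (toℕ i)) + binomialSum n (λ i → a (suc i))
      ≈⟨ +-congʳ (sum-init-last {suc n} (λ i → t (toℕ i))) ⟩
    sum {suc n} (λ i → t (toℕ (Fin.inject₁ i))) + t (toℕ (Fin.fromℕ (suc n))) + binomialSum n (λ i → a (suc i))
      ≈⟨ +-congʳ (+-cong (sum-cong-≋ {suc n} λ i → reflexive (≡.cong t (Fin.toℕ-inject₁ i))) last≈0) ⟩
    binomialSum n a + 0# + binomialSum n (λ i → a (suc i))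
      ≈⟨ +-congʳ (+-identityʳ _) ⟩
    binomialSum n a + binomialSum n (λ i → a (suc i)) ∎
    where
    s t : ℕ → Carrier
    s k = ι (natℚ (n C k)) * a (suc k)
    t k = ι (natℚ (n C k)) * a k

    pascal : ∀ k → ι (natℚ (suc n C suc k)) * a (suc k) ≈ t (suc k) + s k
    pascal k = begin
      ι (natℚ (suc n C suc k)) * a (suc k)
        ≡⟨ ≡.cong (λ m → ι m * a (suc k)) (≡.trans
             (≡.cong natℚ (≡.trans (≡.sym (nCk+nC[k+1]≡[n+1]C[k+1] n k)) (ℕ.+-comm (n C k) (n C suc k))))
             (natℚ-+ (n C suc k) (n C k))) ⟩
      ι (natℚ (n C suc k) ℚ.+ natℚ (n C k)) * a (suc k)
        ≈⟨ *-congʳ (ι-+ (natℚ (n C suc k)) (natℚ (n C k))) ⟩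
      (ι (natℚ (n C suc k)) + ι (natℚ (n C k))) * a (suc k)
        ≈⟨ distribʳ (a (suc k)) _ _ ⟩
      t (suc k) + s k ∎

    last≈0 : t (toℕ (Fin.fromℕ (suc n))) ≈ 0#
    last≈0 = begin
      t (toℕ (Fin.fromℕ (suc n)))  ≡⟨ ≡.cong t (Fin.toℕ-fromℕ (suc n)) ⟩
      t (suc n)                    ≡⟨ ≡.cong (λ m → ι (natℚ m) * a (suc n)) (k>n⇒nCk≡0 (ℕ.n<1+n n)) ⟩
      ι 0ℚ * a (suc n)             ≈⟨ *-congʳ ι-0 ⟩
      0# * a (suc n)               ≈⟨ zeroˡ (a (suc n)) ⟩
      0#                           ∎

  D-0 : D 0# ≈ 0#
  D-0 = identityˡ-unique (D 0#) (D 0#) (trans (sym (D-+ 0# 0#)) (D-cong (+-identityˡ 0#)))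

  iterate-cong : ∀ j {f g} → f ≈ g → iterate D f j ≈ iterate D g j
  iterate-cong zero    f≈g = f≈g
  iterate-cong (suc j) f≈g = iterate-cong j (D-cong f≈g)

  iterate-+ : ∀ j f g → iterate D (f + g) j ≈ iterate D f j + iterate D g j
  iterate-+ zero    f g = refl
  iterate-+ (suc j) f g = trans (iterate-cong j (D-+ f g)) (iterate-+ j (D f) (D g))

  iterate-0 : ∀ j → iterate D 0# j ≈ 0#
  iterate-0 zero    = refl
  iterate-0 (suc j) = trans (iterate-cong j D-0) (iterate-0 j)

  1/_! : ℕ → ℚ
  1/ j ! = (+ 1 / (j ℕ.!)) {{j !≢0}}

  -- Turns the repeated sum produced by the product rule into a scalar that can cancel against a
  -- factorial.
  ×≈ι-* : ∀ n f → n × f ≈ ι (natℚ n) * f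
  ×≈ι-* zero    f = sym (trans (*-congʳ ι-0) (zeroˡ f))
  ×≈ι-* (suc n) f = sym (begin
    ι (natℚ (suc n)) * f         ≡⟨ ≡.cong (λ m → ι m * f) (natℚ-+ 1 n) ⟩
    ι (1ℚ ℚ.+ natℚ n) * f        ≈⟨ *-congʳ (ι-+ 1ℚ (natℚ n)) ⟩
    (ι 1ℚ + ι (natℚ n)) * f      ≈⟨ distribʳ f (ι 1ℚ) (ι (natℚ n)) ⟩
    ι 1ℚ * f + ι (natℚ n) * f    ≈⟨ +-cong (trans (*-congʳ ι-1) (*-identityˡ f)) (sym (×≈ι-* n f)) ⟩
    f + n × f                    ∎)

  -- The divided power of `D`. With the factorial absorbed, commuting past a variable leaves no
  -- numerical factor.
  Dᵈ : ℕ → Carrier → Carrier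
  Dᵈ j f = ι 1/ j ! * iterate D f j

  Dᵈ-+ : ∀ j f g → Dᵈ j (f + g) ≈ Dᵈ j f + Dᵈ j g
  Dᵈ-+ j f g = trans (*-congˡ (iterate-+ j f g)) (distribˡ _ _ _)

  Dᵈ-zero : ∀ f → Dᵈ 0 f ≈ f
  Dᵈ-zero f = trans (*-congʳ ι-1) (*-identityˡ f)

  Dᵈ-constant : ∀ j {f} → D f ≈ 0# → Dᵈ (suc j) f ≈ 0#
  Dᵈ-constant j Df≈0 = trans (*-congˡ (trans (iterate-cong j Df≈0) (iterate-0 j))) (zeroʳ _)

  -- Bracketed exactly like the concrete operator on polynomials, so that both unfold to the same
  -- expression at each constructor of the index.
  𝒢 : ℕ → Carrier → Carrier
  𝒢 zero    f = f
  𝒢 (suc r) f = y ^ suc r * sum {suc r} λ i →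
    ι (natℚ (r C toℕ i)) * (ι 1/ suc (toℕ i) ! * x ^ suc (toℕ i)) * iterate D f (suc (toℕ i))

  𝒢-suc : ∀ r f → 𝒢 (suc r) f ≈ y ^ suc r * binomialSum r (λ i → x ^ suc i * Dᵈ (suc i) f)
  𝒢-suc r f = *-congˡ (sum-cong-≋ {suc r} λ i →
    solve 4 (λ k a b d → k :* (a :* b) :* d := k :* (b :* (a :* d))) refl
      (ι (natℚ (r C toℕ i))) (ι 1/ suc (toℕ i) !) (x ^ suc (toℕ i)) (iterate D f (suc (toℕ i))))

  𝒢-+ : ∀ r f g → 𝒢 r (f + g) ≈ 𝒢 r f + 𝒢 r g
  𝒢-+ zero    f g = refl
  𝒢-+ (suc r) f g = begin
    𝒢 (suc r) (f + g)
      ≈⟨ 𝒢-suc r (f + g) ⟩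
    y ^ suc r * binomialSum r (λ i → x ^ suc i * Dᵈ (suc i) (f + g))
      ≈⟨ *-congˡ (binomialSum-cong r λ i → trans (*-congˡ (Dᵈ-+ (suc i) f g)) (distribˡ (x ^ suc i) (Dᵈ (suc i) f) (Dᵈ (suc i) g))) ⟩
    y ^ suc r * binomialSum r (λ i → x ^ suc i * Dᵈ (suc i) f + x ^ suc i * Dᵈ (suc i) g)
      ≈⟨ *-congˡ (binomialSum-+ r (λ i → x ^ suc i * Dᵈ (suc i) f) (λ i → x ^ suc i * Dᵈ (suc i) g)) ⟩
    y ^ suc r * (binomialSum r (λ i → x ^ suc i * Dᵈ (suc i) f) + binomialSum r (λ i → x ^ suc i * Dᵈ (suc i) g))
      ≈⟨ distribˡ _ _ _ ⟩
    _ ≈⟨ +-cong (𝒢-suc r f) (𝒢-suc r g) ⟨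
    𝒢 (suc r) f + 𝒢 (suc r) g ∎

  𝒢-constant : ∀ r {f} → D f ≈ 0# → 𝒢 (suc r) f ≈ 0#
  𝒢-constant r {f} Df≈0 = trans (𝒢-suc r f) (trans
    (*-congˡ (binomialSum-0 r λ i → trans (*-congˡ (Dᵈ-constant i Df≈0)) (zeroʳ (x ^ suc i))))
    (zeroʳ _))

  -- The commutator of 𝒢 r with multiplication by either variable.
  ℋ : ℕ → Carrier → Carrier
  ℋ zero    f = 0#
  ℋ (suc r) f = y ^ suc r * binomialSum r (λ i → x ^ suc i * Dᵈ i f)

  -- Pascal's rule cuts the sum in two. The half with unshifted index is the previous commutator
  -- times y; in the shifted half one factor x comes out and the sum of `𝒢` remains.
  ℋ-suc : ∀ r f → ℋ (suc r) f ≈ x * (y * 𝒢 r f) + y * ℋ r f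
  -- Index 0 is separate because `𝒢 0` and `ℋ 0` are not given by the sum; both sides come down to x
  -- y f.
  ℋ-suc zero    f = begin
    y * 1# * (ι 1ℚ * (x * 1# * Dᵈ 0 f) + 0#)
      ≈⟨ *-cong (*-identityʳ y) (trans (+-identityʳ _) (trans (*-congʳ ι-1) (trans (*-identityˡ _)
           (*-cong (*-identityʳ x) (Dᵈ-zero f))))) ⟩
    y * (x * f)
      ≈⟨ solve 3 (λ x y f → y :* (x :* f) := x :* (y :* f)) refl x y f ⟩
    x * (y * f)
      ≈⟨ +-identityʳ _ ⟨
    x * (y * f) + 0#
      ≈⟨ +-congˡ (zeroʳ y) ⟨
    x * (y * f) + y * 0# ∎
  ℋ-suc (suc r) f = begin
    y * Y * binomialSum (suc r) a
      ≈⟨ *-congˡ (binomialSum-suc r a) ⟩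
    y * Y * (binomialSum r a + binomialSum r (λ i → x * x ^ suc i * Dᵈ (suc i) f))
      ≈⟨ *-congˡ (+-congˡ (trans (binomialSum-cong r λ i → *-assoc x (x ^ suc i) (Dᵈ (suc i) f)) (binomialSum-* r x b))) ⟩
    y * Y * (binomialSum r a + x * binomialSum r b)
      ≈⟨ solve 5 (λ x y Y a b → y :* Y :* (a :+ x :* b) := x :* (y :* (Y :* b)) :+ y :* (Y :* a)) refl
           x y Y (binomialSum r a) (binomialSum r b) ⟩
    x * (y * (Y * binomialSum r b)) + y * ℋ (suc r) f
      ≈⟨ +-congʳ (*-congˡ (*-congˡ (𝒢-suc r f))) ⟨
    x * (y * 𝒢 (suc r) f) + y * ℋ (suc r) f ∎
    where
    Y : Carrier
    Y = y ^ suc r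
    a b : ℕ → Carrier
    a i = x ^ suc i * Dᵈ i f
    b i = x ^ suc i * Dᵈ (suc i) f

  -- Both x and y can play the part of `v`. Since `ℋ` does not depend on `v`, the two variables get
  -- the same commutator.
  module _ (v : Carrier) (D-v : ∀ f → D (v * f) ≈ f + v * D f) where

    -- The Leibniz formula for a power of `D`: as D v = 1, only the terms with v itself or with one
    -- derivative on v survive.
    iterate-v : ∀ j f → iterate D (v * f) (suc j) ≈ v * iterate D f (suc j) + suc j × iterate D f j
    iterate-v zero    f = trans (D-v f) (trans (+-comm _ _) (+-congˡ (sym (+-identityʳ f))))
    iterate-v (suc j) f = begin
      iterate D (D (v * f)) (suc j)
        ≈⟨ iterate-cong (suc j) (D-v f) ⟩
      iterate D (f + v * D f) (suc j)
        ≈⟨ iterate-+ (suc j) f (v * D f) ⟩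
      g + iterate D (v * D f) (suc j)
        ≈⟨ +-congˡ (iterate-v j (D f)) ⟩
      -- `iterate` applies `D` innermost first, so `iterate D (D f) j` is `g`, and the suc j copies
      -- join the one split off before.
      g + (v * iterate D (D f) (suc j) + suc j × g)
        ≈⟨ solve 3 (λ g h k → g :+ (h :+ k) := h :+ (g :+ k)) refl g (v * iterate D (D f) (suc j)) (suc j × g) ⟩
      v * iterate D f (2 ℕ.+ j) + (2 ℕ.+ j) × g ∎
      where
      g : Carrier
      g = iterate D f (suc j)

    -- The multiplicity j + 1 cancels against (j + 1)! and leaves 1/j!, which is the next lower
    -- divided power.
    Dᵈ-v : ∀ j f → Dᵈ (suc j) (v * f) ≈ v * Dᵈ (suc j) f + Dᵈ j f
    Dᵈ-v j f = begin
      ι 1/ suc j ! * iterate D (v * f) (suc j)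
        ≈⟨ *-congˡ (trans (iterate-v j f) (+-congˡ (×≈ι-* (suc j) (iterate D f j)))) ⟩
      ι 1/ suc j ! * (v * iterate D f (suc j) + ι (natℚ (suc j)) * iterate D f j)
        ≈⟨ solve 5 (λ c v g n h → c :* (v :* g :+ n :* h) := v :* (c :* g) :+ (c :* n) :* h) refl
             (ι 1/ suc j !) v (iterate D f (suc j)) (ι (natℚ (suc j))) (iterate D f j) ⟩
      v * Dᵈ (suc j) f + ι 1/ suc j ! * ι (natℚ (suc j)) * iterate D f j
        ≈⟨ +-congˡ (*-congʳ (ι-* 1/ suc j ! (natℚ (suc j)))) ⟨
      v * Dᵈ (suc j) f + ι (1/ suc j ! ℚ.* natℚ (suc j)) * iterate D f j
        ≡⟨ ≡.cong (λ m → v * Dᵈ (suc j) f + ι m * iterate D f j)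
             (1/mn*m≡1/n (suc j) (j ℕ.!) {{_}} {{j !≢0}} {{suc j !≢0}}) ⟩
      v * Dᵈ (suc j) f + Dᵈ j f ∎

    -- Every divided power either passes `v` or drops by one degree. The dropped terms keep their
    -- power of x, and their sum is `ℋ`.
    𝒢-v : ∀ r f → 𝒢 r (v * f) ≈ v * 𝒢 r f + ℋ r f
    𝒢-v zero    f = sym (+-identityʳ (v * f))
    𝒢-v (suc r) f = begin
      𝒢 (suc r) (v * f)
        ≈⟨ 𝒢-suc r (v * f) ⟩
      Y * binomialSum r (λ i → x ^ suc i * Dᵈ (suc i) (v * f))
        ≈⟨ *-congˡ (binomialSum-cong r λ i → trans (*-congˡ (Dᵈ-v i f))
             (solve 4 (λ X v g h → X :* (v :* g :+ h) := v :* (X :* g) :+ X :* h) refl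
               (x ^ suc i) v (Dᵈ (suc i) f) (Dᵈ i f))) ⟩
      Y * binomialSum r (λ i → v * b i + a i)
        ≈⟨ *-congˡ (trans (binomialSum-+ r (λ i → v * b i) a) (+-congʳ (binomialSum-* r v b))) ⟩
      Y * (v * binomialSum r b + binomialSum r a)
        ≈⟨ solve 4 (λ Y v b a → Y :* (v :* b :+ a) := v :* (Y :* b) :+ Y :* a) refl
             Y v (binomialSum r b) (binomialSum r a) ⟩
      v * (Y * binomialSum r b) + ℋ (suc r) f
        ≈⟨ +-congʳ (*-congˡ (𝒢-suc r f)) ⟨
      v * 𝒢 (suc r) f + ℋ (suc r) f ∎
      where
      Y : Carrier
      Y = y ^ suc r
      a b : ℕ → Carrier
      a i = x ^ suc i * Dᵈ i f
      b i = x ^ suc i * Dᵈ (suc i) f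

-- Generating functions of `𝒢` and `ℋ`, and how `T` transforms multiplication by x and y.

module GeneratingFunction {c ℓ} (R : CommutativeRing c ℓ) (A : DifferentialAlgebra R) where

  private
    module R = CommutativeRing R
  open DifferentialAlgebra A
  open DividedPowers R A using (𝒢; ℋ; 𝒢-v; ℋ-suc; 𝒢-+; 𝒢-constant)
  open PowerSeries R
  open CauchyProduct R using (R[[z]]; constant-*; z-*-zero; z-*-suc)
  open GroupProperties R.+-group using (ε⁻¹≈ε)
  private
    module S = CommutativeRing R[[z]]
  open GroupProperties S.+-group using (∙-cancelʳ)
  open SemiringSolver S.commutativeSemiring using (solve; _:=_; _:+_; _:*_)
  open SetoidReasoning S.setoid

  X Y w x̂ ŷ : Series
  X = constant x
  Y = constant y
  w = 1# - Y * z
  x̂ = X * w ⁻¹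
  ŷ = (Y * (w + X * z)) * w ⁻¹

  T H : R.Carrier → Series
  T f r = 𝒢 r f
  H f r = ℋ r f

  -- The geometric expansion is a true inverse because `w` has constant term 1: the factor z leaves
  -- `Y * z` without one.
  w⁻¹*w : w ⁻¹ * w ≈ 1#
  w⁻¹*w = S.trans {w ⁻¹ * w} {w * w ⁻¹} {1#} (S.*-comm (w ⁻¹) w) (⁻¹-inverseʳ w w₀≈1)
    where
    w₀≈1 : w 0 R.≈ R.1#
    w₀≈1 = R.trans
      (R.+-congˡ (R.trans (R.-‿cong (R.trans (constant-* y z 0) (R.zeroʳ y))) ε⁻¹≈ε))
      (R.+-identityʳ R.1#)

  w+Yz : w + Y * z ≈ 1#
  w+Yz = begin
    1# - Y * z + Y * z        ≈⟨ S.+-assoc 1# (- (Y * z)) (Y * z) ⟩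
    1# + (- (Y * z) + Y * z)  ≈⟨ S.+-congˡ {1#} (S.-‿inverseˡ (Y * z)) ⟩
    1# + 0#                   ≈⟨ S.+-identityʳ 1# ⟩
    1#                        ∎

  [w+Yz]* : ∀ p → (w + Y * z) * p ≈ p
  [w+Yz]* p = S.trans {(w + Y * z) * p} {1# * p} {p} (S.*-congʳ {p} w+Yz) (S.*-identityˡ p)

  T-v : ∀ v → (∀ f → D (v R.* f) R.≈ f R.+ v R.* D f) → ∀ f → T (v R.* f) ≈ constant v * T f + H f
  T-v v D-v f r = R.trans (𝒢-v v D-v r f) (R.+-congʳ (R.sym (constant-* v (T f) r)))

  -- This is `ℋ-suc` with the index shift expressed by z. At index 0 the left side is 0 by
  -- definition and the right side because of its factors z.
  H-recurrence : ∀ f → H f ≈ X * (Y * (z * T f)) + Y * (z * H f)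
  H-recurrence f zero    = R.sym (R.trans
    (R.+-cong
      (R.trans (constant-* x (Y * (z * T f)) 0) (R.trans (R.*-congˡ (Yz*-zero (T f))) (R.zeroʳ x)))
      (Yz*-zero (H f)))
    (R.+-identityˡ R.0#))
    where
    Yz*-zero : ∀ p → (Y * (z * p)) 0 R.≈ R.0#
    Yz*-zero p = R.trans (constant-* y (z * p) 0) (R.trans (R.*-congˡ (z-*-zero p)) (R.zeroʳ y))
  H-recurrence f (suc r) = R.trans (ℋ-suc r f) (R.sym (R.+-cong
    (R.trans (constant-* x (Y * (z * T f)) (suc r)) (R.*-congˡ (Yz*-suc (T f))))
    (Yz*-suc (H f))))
    where
    Yz*-suc : ∀ p → (Y * (z * p)) (suc r) R.≈ y R.* p r
    Yz*-suc p = R.trans (constant-* y (z * p) (suc r)) (R.*-congˡ (z-*-suc p r))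

  -- Solves the recurrence for `H` without subtracting: after `Y * (z * H f)` is added to the left
  -- side, the factor `w + Y * z` is 1.
  w*H : ∀ f → w * H f ≈ X * (Y * (z * T f))
  w*H f = ∙-cancelʳ (Y * (z * H f)) (w * H f) (X * (Y * (z * T f))) (begin
    w * H f + Y * (z * H f)
      ≈⟨ solve 4 (λ w Y z h → w :* h :+ Y :* (z :* h) := (w :+ Y :* z) :* h) (λ _ → R.refl) w Y z (H f) ⟩
    (w + Y * z) * H f
      ≈⟨ [w+Yz]* (H f) ⟩
    H f
      ≈⟨ H-recurrence f ⟩
    X * (Y * (z * T f)) + Y * (z * H f) ∎)

  -- Multiplying the commutator identity by `w` makes `w * H f` a multiple of `T f`; the factor
  -- `w ⁻¹` in front undoes the multiplication.
  T-v′ : ∀ v → (∀ f → D (v R.* f) R.≈ f R.+ v R.* D f) → ∀ f →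
         T (v R.* f) ≈ w ⁻¹ * (constant v * (w * T f) + X * (Y * (z * T f)))
  T-v′ v D-v f = begin
    T (v R.* f)
      ≈⟨ S.*-identityˡ (T (v R.* f)) ⟨
    1# * T (v R.* f)
      ≈⟨ S.*-cong w⁻¹*w (S.sym {T (v R.* f)} (T-v v D-v f)) ⟨
    w ⁻¹ * w * (V * T f + H f)
      ≈⟨ solve 5 (λ i w V t h → i :* w :* (V :* t :+ h) := i :* (V :* (w :* t) :+ w :* h)) (λ _ → R.refl) (w ⁻¹) w V (T f) (H f) ⟩
    w ⁻¹ * (V * (w * T f) + w * H f)
      ≈⟨ S.*-congˡ {w ⁻¹} (S.+-congˡ {V * (w * T f)} (w*H f)) ⟩
    w ⁻¹ * (V * (w * T f) + X * (Y * (z * T f))) ∎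
    where
    V : Series
    V = constant v

  T-x : ∀ f → T (x R.* f) ≈ x̂ * T f
  T-x f = begin
    T (x R.* f)
      ≈⟨ T-v′ x D-x f ⟩
    w ⁻¹ * (X * (w * T f) + X * (Y * (z * T f)))
      -- For x both summands share the factor `X`, and what remains is `w + Y * z`, that is 1.
      ≈⟨ solve 6 (λ i w X Y z t → i :* (X :* (w :* t) :+ X :* (Y :* (z :* t))) := X :* i :* ((w :+ Y :* z) :* t))
           (λ _ → R.refl) (w ⁻¹) w X Y z (T f) ⟩
    x̂ * ((w + Y * z) * T f)
      ≈⟨ S.*-congˡ {x̂} ([w+Yz]* (T f)) ⟩
    x̂ * T f ∎

  T-y : ∀ f → T (y R.* f) ≈ ŷ * T f
  T-y f = begin
    T (y R.* f)
      ≈⟨ T-v′ y D-y f ⟩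
    w ⁻¹ * (Y * (w * T f) + X * (Y * (z * T f)))
      -- For y the common factor is `Y`, and `w + X * z` stays as part of the numerator.
      ≈⟨ solve 6 (λ i w X Y z t → i :* (Y :* (w :* t) :+ X :* (Y :* (z :* t))) := (Y :* (w :+ X :* z)) :* i :* t)
           (λ _ → R.refl) (w ⁻¹) w X Y z (T f) ⟩
    ŷ * T f ∎

  T-+ : ∀ f g → T (f R.+ g) ≈ T f + T g
  T-+ f g r = 𝒢-+ r f g

  T-constant : ∀ {f} → D f R.≈ R.0# → T f ≈ constant f
  T-constant Df≈0 zero    = R.refl
  T-constant Df≈0 (suc r) = 𝒢-constant r Df≈0

  -- Shaped for the induction on exponents: `a` stands for the scalar, `p` and `q` for the powers
  -- reached so far, and the new factor lands where `^` unfolds.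
  T-x-monomial : ∀ f a p q → T f ≈ a * (p * q) → T (x R.* f) ≈ a * (x̂ * p * q)
  T-x-monomial f a p q Tf≈apq = begin
    T (x R.* f)          ≈⟨ T-x f ⟩
    x̂ * T f              ≈⟨ S.*-congˡ {x̂} Tf≈apq ⟩
    x̂ * (a * (p * q))    ≈⟨ solve 4 (λ u a p q → u :* (a :* (p :* q)) := a :* (u :* p :* q)) (λ _ → R.refl) x̂ a p q ⟩
    a * (x̂ * p * q)      ∎

  T-y-monomial : ∀ f a p q → T f ≈ a * (p * q) → T (y R.* f) ≈ a * (p * (ŷ * q))
  T-y-monomial f a p q Tf≈apq = begin
    T (y R.* f)          ≈⟨ T-y f ⟩
    ŷ * T f              ≈⟨ S.*-congˡ {ŷ} Tf≈apq ⟩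
    ŷ * (a * (p * q))    ≈⟨ solve 4 (λ u a p q → u :* (a :* (p :* q)) := a :* (p :* (u :* q))) (λ _ → R.refl) ŷ a p q ⟩
    a * (p * (ŷ * q))    ∎

-- Coefficients of polynomials; Q[x,y] as an instance of the axioms.

open import Defs

private
  module P = CommutativeRing ℚ[x,y]

coeff-++ : ∀ f g k l → coeff (f ++ g) k l ≡ coeff f k l ℚ.+ coeff g k l
coeff-++ []      g k l = ≡.sym (ℚ.+-identityˡ _)
coeff-++ (t ∷ f) g k l = ≡.trans (≡.cong (termCoeff t k l ℚ.+_) (coeff-++ f g k l))
  (≡.sym (ℚ.+-assoc (termCoeff t k l) _ _))

if-*ˡ : ∀ a b {c} → (if b then a ℚ.* c else 0ℚ) ≡ a ℚ.* (if b then c else 0ℚ)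
if-*ˡ a true  = ≡.refl
if-*ˡ a false = ≡.sym (ℚ.*-zeroʳ a)

coeff-x*-zero : ∀ f l → coeff (x P.* f) 0 l ≡ 0ℚ
coeff-x*-zero []      l = ≡.refl
coeff-x*-zero (t ∷ f) l = ≡.trans (ℚ.+-identityˡ _) (coeff-x*-zero f l)

coeff-x*-suc : ∀ f k l → coeff (x P.* f) (suc k) l ≡ coeff f k l
coeff-x*-suc []                  k l = ≡.refl
coeff-x*-suc (c x^ i y^ j ∷ f) k l =
  ≡.cong₂ ℚ._+_ (≡.cong (if (i ≡ᵇ k) ∧ (j ≡ᵇ l) then_else 0ℚ) (ℚ.*-identityˡ c)) (coeff-x*-suc f k l)

coeff-y*-zero : ∀ f k → coeff (y P.* f) k 0 ≡ 0ℚ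
coeff-y*-zero []                  k = ≡.refl
coeff-y*-zero (c x^ i y^ j ∷ f) k rewrite ∧-zeroʳ (i ≡ᵇ k) =
  ≡.trans (ℚ.+-identityˡ _) (coeff-y*-zero f k)

coeff-y*-suc : ∀ f k l → coeff (y P.* f) k (suc l) ≡ coeff f k l
coeff-y*-suc []                  k l = ≡.refl
coeff-y*-suc (c x^ i y^ j ∷ f) k l =
  ≡.cong₂ ℚ._+_ (≡.cong (if (i ≡ᵇ k) ∧ (j ≡ᵇ l) then_else 0ℚ) (ℚ.*-identityˡ c)) (coeff-y*-suc f k l)

-- Differentiation scales by the exponent of the term, the coefficient formula by the index read
-- off. They differ only where both sides are 0.
≡ᵇ-natℚ : ∀ m n b c → (if (m ≡ᵇ n) ∧ b then natℚ m ℚ.* c else 0ℚ) ≡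
                       natℚ n ℚ.* (if (m ≡ᵇ n) ∧ b then c else 0ℚ)
≡ᵇ-natℚ m n b c with m ≡ᵇ n in eq
... | false = ≡.sym (ℚ.*-zeroʳ (natℚ n))
... | true  rewrite ℕ.≡ᵇ⇒≡ m n (≡.subst Bool.T (≡.sym eq) _) = if-*ˡ (natℚ n) b

termCoeff-∂x : ∀ t k l → termCoeff (∂xₜ t) k l ≡ natℚ (suc k) ℚ.* termCoeff t (suc k) l
-- Truncated subtraction leaves the exponent at 0 here, but the scalar is 0 times c, so the spurious
-- term contributes nothing.
termCoeff-∂x (c x^ zero  y^ j) k l = ≡.trans
  (≡.trans (≡.cong (if (0 ≡ᵇ k) ∧ (j ≡ᵇ l) then_else 0ℚ) (ℚ.*-zeroˡ c)) (if-eta ((0 ≡ᵇ k) ∧ (j ≡ᵇ l))))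
  (≡.sym (ℚ.*-zeroʳ (natℚ (suc k))))
termCoeff-∂x (c x^ suc i y^ j) k l = ≡ᵇ-natℚ (suc i) (suc k) (j ≡ᵇ l) c

termCoeff-∂y : ∀ t k l → termCoeff (∂yₜ t) k l ≡ natℚ (suc l) ℚ.* termCoeff t k (suc l)
termCoeff-∂y (c x^ i y^ zero)  k l rewrite ∧-zeroʳ (i ≡ᵇ k) = ≡.trans
  (≡.trans (≡.cong (if (i ≡ᵇ k) ∧ (0 ≡ᵇ l) then_else 0ℚ) (ℚ.*-zeroˡ c)) (if-eta ((i ≡ᵇ k) ∧ (0 ≡ᵇ l))))
  (≡.sym (ℚ.*-zeroʳ (natℚ (suc l))))
termCoeff-∂y (c x^ i y^ suc j) k l rewrite ∧-comm (i ≡ᵇ k) (j ≡ᵇ l) =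
  ≡ᵇ-natℚ (suc j) (suc l) (i ≡ᵇ k) c

coeff-∂x : ∀ f k l → coeff (∂x f) k l ≡ natℚ (suc k) ℚ.* coeff f (suc k) l
coeff-∂x []      k l = ≡.sym (ℚ.*-zeroʳ (natℚ (suc k)))
coeff-∂x (t ∷ f) k l = ≡.trans (≡.cong₂ ℚ._+_ (termCoeff-∂x t k l) (coeff-∂x f k l))
  (≡.sym (ℚ.*-distribˡ-+ (natℚ (suc k)) _ _))

coeff-∂y : ∀ f k l → coeff (∂y f) k l ≡ natℚ (suc l) ℚ.* coeff f k (suc l)
coeff-∂y []      k l = ≡.sym (ℚ.*-zeroʳ (natℚ (suc l)))
coeff-∂y (t ∷ f) k l = ≡.trans (≡.cong₂ ℚ._+_ (termCoeff-∂y t k l) (coeff-∂y f k l))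
  (≡.sym (ℚ.*-distribˡ-+ (natℚ (suc l)) _ _))

coeff-D : ∀ f k l → coeff (D f) k l ≡
          natℚ (suc k) ℚ.* coeff f (suc k) l ℚ.+ natℚ (suc l) ℚ.* coeff f k (suc l)
coeff-D f k l = ≡.trans (coeff-++ (∂x f) (∂y f) k l) (≡.cong₂ ℚ._+_ (coeff-∂x f k l) (coeff-∂y f k l))

natℚ-suc-* : ∀ n a → natℚ (suc n) ℚ.* a ≡ a ℚ.+ natℚ n ℚ.* a
natℚ-suc-* n a = begin
  natℚ (suc n) ℚ.* a             ≡⟨ ≡.cong (ℚ._* a) (natℚ-+ 1 n) ⟩
  (1ℚ ℚ.+ natℚ n) ℚ.* a          ≡⟨ ℚ.*-distribʳ-+ a 1ℚ (natℚ n) ⟩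
  1ℚ ℚ.* a ℚ.+ natℚ n ℚ.* a      ≡⟨ ≡.cong (ℚ._+ natℚ n ℚ.* a) (ℚ.*-identityˡ a) ⟩
  a ℚ.+ natℚ n ℚ.* a             ∎
  where open ≡.≡-Reasoning

-- `D` acts on lists of terms, so invariance needs an argument: by `coeff-D` the coefficients of a
-- derivative depend only on those of the polynomial.
D-cong : ∀ {f g} → f ≈ₚ g → D f ≈ₚ D g
D-cong {f} {g} f≈g = mk≈ λ k l → ≡.trans (coeff-D f k l) (≡.trans
  (≡.cong₂ (λ a b → natℚ (suc k) ℚ.* a ℚ.+ natℚ (suc l) ℚ.* b) (coeff≡ f≈g (suc k) l) (coeff≡ f≈g k (suc l)))
  (≡.sym (coeff-D g k l)))

D-+ : ∀ f g → D (f P.+ g) ≈ₚ D f P.+ D g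
D-+ f g = P.trans
  (P.reflexive (≡.cong₂ _++_ (map-++ ∂xₜ f g) (map-++ ∂yₜ f g)))
  (interchange (∂x f) (∂x g) (∂y f) (∂y g))
  where open CommutativeSemigroupProperties P.+-commutativeSemigroup using (interchange)

D-x* : ∀ f → D (x P.* f) ≈ₚ f P.+ x P.* D f
D-x* f = mk≈ λ k l → ≡.trans (coeff-D (x P.* f) k l)
  (≡.trans (helper k l) (≡.sym (coeff-++ f (x P.* D f) k l)))
  where
  open ≡.≡-Reasoning
  helper : ∀ k l →
    natℚ (suc k) ℚ.* coeff (x P.* f) (suc k) l ℚ.+ natℚ (suc l) ℚ.* coeff (x P.* f) k (suc l) ≡
    coeff f k l ℚ.+ coeff (x P.* D f) k l
  helper zero    l = ≡.cong₂ ℚ._+_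
    (≡.trans (ℚ.*-identityˡ _) (coeff-x*-suc f 0 l))
    (≡.trans (≡.cong (natℚ (suc l) ℚ.*_) (coeff-x*-zero f (suc l)))
      (≡.trans (ℚ.*-zeroʳ (natℚ (suc l))) (≡.sym (coeff-x*-zero (D f) l))))
  helper (suc k) l = begin
    natℚ (2 ℕ.+ k) ℚ.* coeff (x P.* f) (2 ℕ.+ k) l ℚ.+ natℚ (suc l) ℚ.* coeff (x P.* f) (suc k) (suc l)
      ≡⟨ ≡.cong₂ (λ a b → natℚ (2 ℕ.+ k) ℚ.* a ℚ.+ natℚ (suc l) ℚ.* b) (coeff-x*-suc f (suc k) l) (coeff-x*-suc f k (suc l)) ⟩
    natℚ (2 ℕ.+ k) ℚ.* coeff f (suc k) l ℚ.+ natℚ (suc l) ℚ.* coeff f k (suc l)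
      -- Of the k + 2 copies one is the summand f of the product rule; the other k + 1 belong to x
      -- times `D f`.
      ≡⟨ ≡.cong (ℚ._+ natℚ (suc l) ℚ.* coeff f k (suc l)) (natℚ-suc-* (suc k) (coeff f (suc k) l)) ⟩
    coeff f (suc k) l ℚ.+ natℚ (suc k) ℚ.* coeff f (suc k) l ℚ.+ natℚ (suc l) ℚ.* coeff f k (suc l)
      ≡⟨ ℚ.+-assoc (coeff f (suc k) l) _ _ ⟩
    coeff f (suc k) l ℚ.+ (natℚ (suc k) ℚ.* coeff f (suc k) l ℚ.+ natℚ (suc l) ℚ.* coeff f k (suc l))
      ≡⟨ ≡.cong (coeff f (suc k) l ℚ.+_) (≡.trans (coeff-x*-suc (D f) k l) (coeff-D f k l)) ⟨
    coeff f (suc k) l ℚ.+ coeff (x P.* D f) (suc k) l ∎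

D-y* : ∀ f → D (y P.* f) ≈ₚ f P.+ y P.* D f
D-y* f = mk≈ λ k l → ≡.trans (coeff-D (y P.* f) k l)
  (≡.trans (helper k l) (≡.sym (coeff-++ f (y P.* D f) k l)))
  where
  open ≡.≡-Reasoning
  open CommutativeSemigroupProperties
    (CommutativeRing.+-commutativeSemigroup ℚ.+-*-commutativeRing) using (x∙yz≈y∙xz)
  helper : ∀ k l →
    natℚ (suc k) ℚ.* coeff (y P.* f) (suc k) l ℚ.+ natℚ (suc l) ℚ.* coeff (y P.* f) k (suc l) ≡
    coeff f k l ℚ.+ coeff (y P.* D f) k l
  helper k zero    = ≡.trans (ℚ.+-comm (natℚ (suc k) ℚ.* coeff (y P.* f) (suc k) 0) _) (≡.cong₂ ℚ._+_
    (≡.trans (ℚ.*-identityˡ _) (coeff-y*-suc f k 0))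
    (≡.trans (≡.cong (natℚ (suc k) ℚ.*_) (coeff-y*-zero f (suc k)))
      (≡.trans (ℚ.*-zeroʳ (natℚ (suc k))) (≡.sym (coeff-y*-zero (D f) k)))))
  helper k (suc l) = begin
    natℚ (suc k) ℚ.* coeff (y P.* f) (suc k) (suc l) ℚ.+ natℚ (2 ℕ.+ l) ℚ.* coeff (y P.* f) k (2 ℕ.+ l)
      ≡⟨ ≡.cong₂ (λ a b → natℚ (suc k) ℚ.* a ℚ.+ natℚ (2 ℕ.+ l) ℚ.* b) (coeff-y*-suc f (suc k) l) (coeff-y*-suc f k (suc l)) ⟩
    natℚ (suc k) ℚ.* coeff f (suc k) l ℚ.+ natℚ (2 ℕ.+ l) ℚ.* coeff f k (suc l)
      ≡⟨ ≡.cong (natℚ (suc k) ℚ.* coeff f (suc k) l ℚ.+_) (natℚ-suc-* (suc l) (coeff f k (suc l))) ⟩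
    natℚ (suc k) ℚ.* coeff f (suc k) l ℚ.+ (coeff f k (suc l) ℚ.+ natℚ (suc l) ℚ.* coeff f k (suc l))
      ≡⟨ x∙yz≈y∙xz (natℚ (suc k) ℚ.* coeff f (suc k) l) (coeff f k (suc l)) _ ⟩
    coeff f k (suc l) ℚ.+ (natℚ (suc k) ℚ.* coeff f (suc k) l ℚ.+ natℚ (suc l) ℚ.* coeff f k (suc l))
      ≡⟨ ≡.cong (coeff f k (suc l) ℚ.+_) (≡.trans (coeff-y*-suc (D f) k l) (coeff-D f k l)) ⟨
    coeff f k (suc l) ℚ.+ coeff (y P.* D f) k (suc l) ∎

const-0 : const 0ℚ ≈ₚ P.0#
const-0 = mk≈ λ k l → ≡.trans (ℚ.+-identityʳ _) (if-eta ((0 ≡ᵇ k) ∧ (0 ≡ᵇ l)))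

const-+ : ∀ a b → const (a ℚ.+ b) ≈ₚ const a P.+ const b
const-+ a b = mk≈ λ k l → if-+ ((0 ≡ᵇ k) ∧ (0 ≡ᵇ l))
  where
  if-+ : ∀ t → (if t then a ℚ.+ b else 0ℚ) ℚ.+ 0ℚ ≡
               (if t then a else 0ℚ) ℚ.+ ((if t then b else 0ℚ) ℚ.+ 0ℚ)
  if-+ true  = ℚ.+-assoc a b 0ℚ
  if-+ false = ≡.refl

-- The derivative is a list of two terms with scalar 0, hence zero only up to `≈ₚ`.
D-const : ∀ c → D (const c) ≈ₚ P.0#
D-const c = P.trans
  (P.+-cong (P.reflexive (≡.cong const (ℚ.*-zeroˡ c))) (P.reflexive (≡.cong const (ℚ.*-zeroˡ c))))
  (P.+-cong const-0 const-0)

ℚ[x,y]-differentialAlgebra : DifferentialAlgebra ℚ[x,y]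
ℚ[x,y]-differentialAlgebra = record
  { x = x ; y = y
  ; ι      = const
  ; ι-0    = const-0
  ; ι-1    = P.refl
  ; ι-+    = const-+
  ; ι-*    = λ a b → P.refl
  ; D      = D
  ; D-cong = D-cong
  ; D-+    = D-+
  ; D-x    = D-x*
  ; D-y    = D-y*
  }

-- Evaluation on monomials and the final identity.

private
  module G = GeneratingFunction ℚ[x,y] ℚ[x,y]-differentialAlgebra
  module S = CommutativeRing (CauchyProduct.R[[z]] ℚ[x,y])

T-term : ∀ c i j → G.T (c x^ i y^ j ∷ []) ≈ constant (const c) * (G.x̂ ^ i * G.ŷ ^ j)
T-term c zero zero = begin
  G.T (const c)                        ≈⟨ G.T-constant (D-const c) ⟩
  constant (const c)                   ≈⟨ S.*-identityʳ (constant (const c)) ⟨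
  constant (const c) * 1#              ≈⟨ S.*-congˡ {constant (const c)} (S.*-identityˡ 1#) ⟨
  constant (const c) * (1# * 1#)       ∎
  where open SetoidReasoning S.setoid
-- Multiplying by a variable yields the scalar `1ℚ ℚ.* c`, so the result is transported along the
-- unit law. The powers of x are peeled off before those of y.
T-term c zero (suc j) = ≡.subst
  (λ a → G.T (a x^ 0 y^ suc j ∷ []) ≈ constant (const c) * (1# * (G.ŷ * G.ŷ ^ j)))
  (ℚ.*-identityˡ c)
  (G.T-y-monomial (c x^ 0 y^ j ∷ []) (constant (const c)) 1# (G.ŷ ^ j) (T-term c zero j))
T-term c (suc i) j = ≡.subst
  (λ a → G.T (a x^ suc i y^ j ∷ []) ≈ constant (const c) * (G.x̂ * G.x̂ ^ i * G.ŷ ^ j))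
  (ℚ.*-identityˡ c)
  (G.T-x-monomial (c x^ i y^ j ∷ []) (constant (const c)) (G.x̂ ^ i) (G.ŷ ^ j) (T-term c i j))

T-⟦⟧ : ∀ f → G.T f ≈ f ⟦ G.x̂ , G.ŷ ⟧
T-⟦⟧ []                = S.trans {G.T []} {constant []} {0#} (G.T-constant P.refl) λ where
  zero    → P.refl
  (suc n) → P.refl
T-⟦⟧ (c x^ i y^ j ∷ f) r = P.trans (G.T-+ (c x^ i y^ j ∷ []) f r) (P.+-cong (T-term c i j r) (T-⟦⟧ f r))

lemma4 :
    (f : Poly) →
    let X = constant x
        Y = constant y
    in
    (λ r → 𝒢 r f) ≈ f ⟦ X * (1# - Y * z) ⁻¹ , (Y * (1# - Y * z + X * z)) * (1# - Y * z) ⁻¹ ⟧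
-- The concrete and the abstract `𝒢` are separate recursive definitions; they agree by computation
-- only once the index is a constructor.
lemma4 f zero    = T-⟦⟧ f zero
lemma4 f (suc r) = T-⟦⟧ f (suc r)
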